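{- Let $G$ be a connected graph that is not a path, not a cycle, and not the claw graph $K_{1,3}$. Then $L^n(G)$ is not representable for every integer $n \geqslant 4$.
   Context: All graphs are finite and simple. For a word $W$ over an alphabet, two distinct letters $x,y$ alternate in $W$ if both occur in $W$ and, after erasing all other letters from $W$, one obtains a word of the form $xyxy\ldots$ or $yxyx\ldots$ (an alternating word of any length). A graph $G=(V,E)$ is representable if there exists a word $W$ over the alphabet $V$ in which every vertex occurs, such that for all distinct $x,y\in V$, the letters $x$ and $y$ alternate in $W$ if and only if $(x,y)\in E$. The line graph $L(G)$ of a graph $G$ has the edges of $G$ as vertices, two of them being adjacent in $L(G)$ iff they share an endpoint in $G$. $L^n(G)$ denotes the graph obtained from $G$ by applying the line graph operation $n$ times. -}

module Defs where

open import Data.Fin using (Fin; toℕ)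
open import Data.Fin.Properties using (_≟_; _<?_)
open import Data.List using (List; []; _∷_; length; lookup; filter; allFin; cartesianProduct)
open import Data.List.Membership.Propositional using (_∈_)
import Data.Nat as ℕ
open import Data.Nat using (ℕ; zero; suc; _+_; _≥_)
open import Data.Nat.Properties using (1+n≢n; <⇒≱)
open import Data.Product using (_×_; _,_; ∃-syntax)
open import Data.Sum using (_⊎_; inj₁; inj₂; [_,_]; swap)
open import Function.Bundles using (_⇔_; _↔_; Inverse)
open import Level using (0ℓ)
open import Relation.Binary.Construct.Closure.ReflexiveTransitive using (Star)
open import Relation.Binary.Core using (Rel)
open import Relation.Binary.Definitions using (Symmetric; Decidable)
open import Relation.Binary.PropositionalEquality using (_≡_; _≢_; refl; sym)
open import Relation.Nullary using (¬_; ¬?; _×-dec_; _⊎-dec_)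

-- Finite simple graphs, with vertices numbered 0, …, order − 1.
record Graph : Set₁ where
  field
    order    : ℕ
    Adj      : Rel (Fin order) 0ℓ
    adj?     : Decidable Adj
    adj-sym  : Symmetric Adj
    loopless : ∀ v → ¬ Adj v v

  Vertex : Set
  Vertex = Fin order

open Graph using (order; Vertex)

record _≅_ (G H : Graph) : Set where
  field
    bijection : Vertex G ↔ Vertex H
    preserves : ∀ u v →
      Graph.Adj G u v ⇔ Graph.Adj H (Inverse.to bijection u) (Inverse.to bijection v)

infix 4 _≅_

-- The graph with no vertices does not count as connected.
Connected : Graph → Set
Connected G = Vertex G × (∀ u v → Star (Graph.Adj G) u v)

undirected : ∀ n (R : Rel (Fin n) 0ℓ) → Decidable R → (∀ i → ¬ R i i) → Graph
undirected n R R? irr = record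
  { order    = n
  ; Adj      = λ i j → R i j ⊎ R j i
  ; adj?     = λ i j → R? i j ⊎-dec R? j i
  ; adj-sym  = swap
  ; loopless = λ i → [ irr i , irr i ]
  }

pathGraph : ℕ → Graph
pathGraph n = undirected n
  (λ i j → suc (toℕ i) ≡ toℕ j)
  (λ i j → suc (toℕ i) ℕ.≟ toℕ j)
  (λ i → 1+n≢n)

-- For n ≥ 3 this is the cycle on n vertices: the path on n vertices together
-- with an edge joining its two ends.  The condition n ≥ 3 is imposed in IsCycle.
cycleGraph : ℕ → Graph
cycleGraph n = undirected n
  (λ i j → suc (toℕ i) ≡ toℕ j ⊎ (i ≢ j × toℕ i ≡ 0 × suc (toℕ j) ≡ n))
  (λ i j → (suc (toℕ i) ℕ.≟ toℕ j) ⊎-dec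
           (¬? (i ≟ j) ×-dec (toℕ i ℕ.≟ 0) ×-dec (suc (toℕ j) ℕ.≟ n)))
  (λ i → [ 1+n≢n , (λ (i≢i , _) → i≢i refl) ])

completeBipartite : ℕ → ℕ → Graph
completeBipartite m n = undirected (m + n)
  (λ i j → toℕ i ℕ.< m × m ℕ.≤ toℕ j)
  (λ i j → (toℕ i ℕ.<? m) ×-dec (m ℕ.≤? toℕ j))
  (λ i (i<m , m≤i) → <⇒≱ i<m m≤i)

IsPath : Graph → Set
IsPath G = ∃[ n ] (n ≥ 1 × G ≅ pathGraph n)

IsCycle : Graph → Set
IsCycle G = ∃[ n ] (n ≥ 3 × G ≅ cycleGraph n)

IsClaw : Graph → Set
IsClaw G = G ≅ completeBipartite 1 3

module _ (G : Graph) where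
  open Graph G using (Adj; adj?)

  -- Each edge {u , v} is listed exactly once, as the pair (u , v) with u < v.
  edges : List (Vertex G × Vertex G)
  edges = filter (λ (u , v) → (u <? v) ×-dec adj? u v)
                 (cartesianProduct (allFin (order G)) (allFin (order G)))

ShareEndpoint : ∀ {n} → Rel (Fin n × Fin n) 0ℓ
ShareEndpoint (a , b) (c , d) = (a ≡ c ⊎ a ≡ d) ⊎ (b ≡ c ⊎ b ≡ d)

shareEndpoint? : ∀ {n} → Decidable (ShareEndpoint {n})
shareEndpoint? (a , b) (c , d) =
  (a ≟ c ⊎-dec a ≟ d) ⊎-dec (b ≟ c ⊎-dec b ≟ d)

shareEndpoint-sym : ∀ {n} → Symmetric (ShareEndpoint {n})
shareEndpoint-sym (inj₁ (inj₁ a≡c)) = inj₁ (inj₁ (sym a≡c))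
shareEndpoint-sym (inj₁ (inj₂ a≡d)) = inj₂ (inj₁ (sym a≡d))
shareEndpoint-sym (inj₂ (inj₁ b≡c)) = inj₁ (inj₂ (sym b≡c))
shareEndpoint-sym (inj₂ (inj₂ b≡d)) = inj₂ (inj₂ (sym b≡d))

lineGraph : Graph → Graph
lineGraph G = record
  { order    = length (edges G)
  ; Adj      = λ e f → e ≢ f × ShareEndpoint (lookup (edges G) e) (lookup (edges G) f)
  ; adj?     = λ e f → ¬? (e ≟ f) ×-dec
                       shareEndpoint? (lookup (edges G) e) (lookup (edges G) f)
  ; adj-sym  = λ (e≢f , s) → (λ f≡e → e≢f (sym f≡e)) , shareEndpoint-sym s
  ; loopless = λ e (e≢e , _) → e≢e refl
  }

lineGraph^ : ℕ → Graph → Graph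
lineGraph^ zero    G = G
lineGraph^ (suc n) G = lineGraph (lineGraph^ n G)

restrict : ∀ {n} → Fin n → Fin n → List (Fin n) → List (Fin n)
restrict x y = filter (λ z → z ≟ x ⊎-dec z ≟ y)

-- The word xyxy… of length k.
alternating : ∀ {A : Set} → A → A → ℕ → List A
alternating x y zero    = []
alternating x y (suc k) = x ∷ alternating y x k

Alternate : ∀ {n} → List (Fin n) → Rel (Fin n) 0ℓ
Alternate W x y =
  x ∈ W × y ∈ W ×
  ∃[ k ] (restrict x y W ≡ alternating x y k ⊎ restrict x y W ≡ alternating y x k)

Represents : (G : Graph) → List (Vertex G) → Set
Represents G W =
  (∀ v → v ∈ W) × (∀ x y → x ≢ y → Alternate W x y ⇔ Graph.Adj G x y)

Representable : Graph → Set
Representable G = ∃[ W ] Represents G W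

{-# OPTIONS --safe #-}

-- In a word W representing G let x ≽ y mean that every prefix of W contains x
-- at least as often as y.  Adjacent letters are comparable in this preorder, and
-- adjacency passes to subintervals: if x ≽ y ≽ z and x ~ z, then x ~ y and y ~ z
-- (for distinct letters).  The line graph of the wheel W₄ admits no such
-- preorder: its spokes form a clique, hence a chain, and wherever that chain puts
-- them some rim edge cannot be placed.  A non-induced copy of W₄ in G becomes an
-- induced copy of L(W₄) in L(G), so it suffices to find W₄ in Lⁿ(G) for n ≥ 3.
-- A maximal path shows that a connected graph without vertices of degree ≥ 3 is a
-- path or a cycle; any other G except the claw contains K₁,₄, a fork or a paw, and
-- fork → paw → diamond → W₄ and K₁,₄ → diamond under successive line graphs,
-- while W₄ contains a diamond and therefore persists.
module Submission where

open import Defs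
open import Data.Nat using (ℕ; _≥_)
open import Relation.Nullary using (¬_)

open import Data.Empty using (⊥; ⊥-elim)
open import Data.Fin using (Fin; zero; suc; toℕ; fromℕ; fromℕ<; inject₁; opposite)
import Data.Fin as Fin
open import Data.Fin.Patterns using (0F; 1F; 2F; 3F)
open import Data.Fin.Properties using
  ( _≟_; any?; toℕ-injective; toℕ-fromℕ; toℕ-fromℕ<; toℕ-inject₁; toℕ<n; injective⇒≤
  ; opposite-prop; opposite-involutive )
import Data.Fin.Properties as Fin
open import Data.List using (List; []; _∷_; length; filter; take; lookup)
open import Data.List.Membership.Propositional using (_∈_)
open import Data.List.Membership.Propositional.Properties
  using (∈-filter⁺; ∈-cartesianProduct⁺; ∈-allFin)
open import Data.List.Properties using (filter-accept; filter-reject; ∷-injectiveˡ; ∷-injectiveʳ)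
open import Data.List.Relation.Unary.Any.Properties using (lookup-index)
open import Data.Nat using (zero; suc; _≤_; _<_; _≤′_; ≤′-refl; ≤′-step; _+_; _∸_; z≤n; s≤s; s≤s⁻¹; _≤?_)
open import Data.Nat.Properties using
  ( ≤-trans; ≤-reflexive; n≤1+n; n<1+n; <-cmp; <⇒≱; <-irrefl; <-asym; suc-injective
  ; +-identityʳ; +-suc; +-∸-assoc; m≤n⇒m<n∨m≡n; ≤⇒≤′ )
open import Data.Product using (_×_; _,_; proj₁; proj₂; map₂; ∃-syntax; Σ-syntax)
open import Data.Sum using (_⊎_; inj₁; inj₂; map; swap)
open import Function using (_∘_; id)
open import Function.Bundles using (_⇔_; mk⇔; mk↔ₛ′; Equivalence)
open import Function.Definitions using (Injective)
open import Level using (0ℓ)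
open import Relation.Binary.Construct.Closure.ReflexiveTransitive using (Star; ε; _◅_)
open import Relation.Binary.Core using (Rel)
open import Relation.Binary.Definitions using (tri<; tri≈; tri>)
open import Relation.Binary.PropositionalEquality
open import Relation.Nullary using (Dec; yes; no; ¬?; _×-dec_; contradiction)
open import Relation.Nullary.Decidable using (map′; decidable-stable)

open Graph using (Vertex; Adj; order)

adj⇒≢ : ∀ G {u v} → Adj G u v → u ≢ v
adj⇒≢ G u~u refl = Graph.loopless G _ u~u

private variable
  n : ℕ

-- Words as preorders

-- These axioms are self-dual: the opposite preorder satisfies them with `convexˡ` and `convexʳ`
-- exchanged, which `reverse` exploits.
record WordOrder (G : Graph) : Set₁ where
  infix 4 _≽_
  field
    _≽_     : Vertex G → Vertex G → Set
    ≽-trans : ∀ {x y z} → x ≽ y → y ≽ z → x ≽ z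
    compare : ∀ {x y} → Adj G x y → x ≽ y ⊎ y ≽ x
    convexˡ : ∀ {x y z} → x ≽ y → y ≽ z → Adj G x z → x ≢ y → Adj G x y
    convexʳ : ∀ {x y z} → x ≽ y → y ≽ z → Adj G x z → y ≢ z → Adj G y z

occurrences : Fin n → ℕ → List (Fin n) → ℕ
occurrences x k W = length (filter (_≟ x) (take k W))

occurrences-here : ∀ {x : Fin n} {W} k → occurrences x (suc k) (x ∷ W) ≡ suc (occurrences x k W)
occurrences-here {x = x} k = cong length (filter-accept (_≟ x) refl)

occurrences-there : ∀ {x z : Fin n} {W} → z ≢ x → ∀ k → occurrences x (suc k) (z ∷ W) ≡ occurrences x k W
occurrences-there {x = x} z≢x k = cong length (filter-reject (_≟ x) z≢x)

-- For distinct letters, `Balanced W x y` is alternation with `x` first: in every prefix the lead of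
-- `x` over `y` is 0 or 1.
Dominates Balanced : List (Fin n) → Fin n → Fin n → Set
Dominates W x y = ∀ k → occurrences y k W ≤ occurrences x k W
Balanced  W x y = ∀ k → occurrences y k W ≤ occurrences x k W
                      × occurrences x k W ≤ suc (occurrences y k W)

balanced-there : ∀ {x y z : Fin n} {W} → z ≢ x → z ≢ y → Balanced W x y → Balanced (z ∷ W) x y
balanced-there z≢x z≢y b zero = z≤n , z≤n
balanced-there {W = W} z≢x z≢y b (suc k)
  rewrite occurrences-there {W = W} z≢x k | occurrences-there {W = W} z≢y k = b k

balanced-there⁻ : ∀ {x y z : Fin n} {W} → z ≢ x → z ≢ y → Balanced (z ∷ W) x y → Balanced W x y
balanced-there⁻ {W = W} z≢x z≢y b k
  with b (suc k)
... | bₖ rewrite occurrences-there {W = W} z≢x k | occurrences-there {W = W} z≢y k = bₖ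

-- After the leading `x` it is the turn of `y`: a lead of 0 or 1 for `y` in the rest becomes a lead
-- of 1 or 0 for `x`.
balanced-here : ∀ {x y : Fin n} {W} → x ≢ y → Balanced W y x → Balanced (x ∷ W) x y
balanced-here x≢y b zero = z≤n , z≤n
balanced-here {x = x} {W = W} x≢y b (suc k)
  rewrite occurrences-here {x = x} {W = W} k | occurrences-there {W = W} x≢y k
  = proj₂ (b k) , s≤s (proj₁ (b k))

balanced-here⁻ : ∀ {x y : Fin n} {W} → x ≢ y → Balanced (x ∷ W) x y → Balanced W y x
balanced-here⁻ {x = x} {W = W} x≢y b k
  with b (suc k)
... | bₖ rewrite occurrences-here {x = x} {W = W} k | occurrences-there {W = W} x≢y k
  = s≤s⁻¹ (proj₂ bₖ) , proj₁ bₖ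

¬balanced-here : ∀ {x y : Fin n} {W} → x ≢ y → ¬ Balanced (y ∷ W) x y
-- The prefix of length 1 contains `y` but not `x`.
¬balanced-here {y = y} {W = W} x≢y b with proj₁ (b 1)
... | y≤x rewrite occurrences-here {x = y} {W = W} 0 | occurrences-there {W = W} (≢-sym x≢y) 0
  with () ← y≤x

-- The inductions below exchange the two letters after each one they meet.
restrict-comm : ∀ (x y : Fin n) W → restrict x y W ≡ restrict y x W
restrict-comm x y [] = refl
restrict-comm x y (z ∷ W) with z ≟ x | z ≟ y
... | yes _ | yes _ = cong (z ∷_) (restrict-comm x y W)
... | yes _ | no  _ = cong (z ∷_) (restrict-comm x y W)
... | no  _ | yes _ = cong (z ∷_) (restrict-comm x y W)
... | no  _ | no  _ = restrict-comm x y W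

alternating⇒balanced : ∀ (W : List (Fin n)) {x y} → x ≢ y →
  ∀ k → restrict x y W ≡ alternating x y k → Balanced W x y
alternating⇒balanced []      x≢y _ _ zero    = z≤n , z≤n
alternating⇒balanced []      x≢y _ _ (suc _) = z≤n , z≤n
alternating⇒balanced (z ∷ W) {x} {y} x≢y k eq with z ≟ x | z ≟ y | k | eq
... | yes refl | yes refl | _     | _  = contradiction refl x≢y
... | yes refl | no  _    | suc k | eq
  = balanced-here x≢y (alternating⇒balanced W (≢-sym x≢y) k
      (trans (restrict-comm y x W) (∷-injectiveʳ eq)))
... | no  z≢x  | yes refl | suc k | eq = contradiction (∷-injectiveˡ eq) z≢x
... | no  z≢x  | no  z≢y  | k     | eq
  = balanced-there z≢x z≢y (alternating⇒balanced W x≢y k eq)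

balanced⇒alternating : ∀ (W : List (Fin n)) {x y} → x ≢ y →
  Balanced W x y → ∃[ k ] restrict x y W ≡ alternating x y k
balanced⇒alternating [] x≢y b = 0 , refl
balanced⇒alternating (z ∷ W) {x} {y} x≢y b with z ≟ x | z ≟ y
... | yes refl | yes refl = contradiction refl x≢y
... | yes refl | no _ with k , eq ← balanced⇒alternating W (≢-sym x≢y) (balanced-here⁻ x≢y b)
  = suc k , cong (x ∷_) (trans (restrict-comm x y W) eq)
balanced⇒alternating (z ∷ W) x≢y b | no _   | yes refl = contradiction b (¬balanced-here x≢y)
balanced⇒alternating (z ∷ W) x≢y b | no z≢x | no z≢y
  = balanced⇒alternating W x≢y (balanced-there⁻ z≢x z≢y b)

-- Convexity is a squeeze: if `x ~ z`, the count of `x` exceeds that of `z` by at most 1 in each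
-- prefix. The count of `y` lies between the two, so both of its differences are 0 or 1, which is
-- alternation.
representable⇒wordOrder : ∀ G → Representable G → WordOrder G
representable⇒wordOrder G (W , occurs , represents) = record
  { _≽_     = Dominates W
  ; ≽-trans = λ x≽y y≽z k → ≤-trans (y≽z k) (x≽y k)
  ; compare = λ x~y → map (λ b k → proj₁ (b k)) (λ b k → proj₁ (b k)) (balanced x~y)
  ; convexˡ = λ x≽y y≽z x~z x≢y → adjacent x≢y λ k →
      x≽y k , ≤-trans (trails x≽y y≽z x~z k) (s≤s (y≽z k))
  ; convexʳ = λ x≽y y≽z x~z y≢z → adjacent y≢z λ k →
      y≽z k , ≤-trans (x≽y k) (trails x≽y y≽z x~z k)
  }
  where
  balanced : ∀ {x y} → Adj G x y → Balanced W x y ⊎ Balanced W y x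
  balanced {x} {y} x~y with Equivalence.from (represents x y (adj⇒≢ G x~y)) x~y
  ... | _ , _ , k , inj₁ eq = inj₁ (alternating⇒balanced W (adj⇒≢ G x~y) k eq)
  ... | _ , _ , k , inj₂ eq = inj₂ (alternating⇒balanced W (≢-sym (adj⇒≢ G x~y)) k
                                     (trans (restrict-comm y x W) eq))

  adjacent : ∀ {x y} → x ≢ y → Balanced W x y → Adj G x y
  adjacent {x} {y} x≢y b = Equivalence.to (represents x y x≢y)
    (occurs x , occurs y , map₂ inj₁ (balanced⇒alternating W x≢y b))

  trails : ∀ {x y z} → Dominates W x y → Dominates W y z → Adj G x z →
    ∀ k → occurrences x k W ≤ suc (occurrences z k W)
  trails x≽y y≽z x~z k with balanced x~z
  ... | inj₁ b = proj₂ (b k)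
  ... | inj₂ b = ≤-trans (proj₁ (b k)) (n≤1+n _)

-- Line graphs

private variable
  G : Graph

module _ (G : Graph) where
  -- The edge list stores the smaller vertex first; `Endpoints` forgets that order. Applying `swap`
  -- re-orients an edge, so `incident⇒adj` need only treat a common first endpoint.
  Endpoints : Vertex (lineGraph G) → Vertex G → Vertex G → Set
  Endpoints e u v = lookup (edges G) e ≡ (u , v) ⊎ lookup (edges G) e ≡ (v , u)

  listed : ∀ {u v} → u Fin.< v → Adj G u v → (u , v) ∈ edges G
  listed u<v u~v = ∈-filter⁺ _ (∈-cartesianProduct⁺ (∈-allFin _) (∈-allFin _)) (u<v , u~v)

  edge∃ : ∀ {u v} → Adj G u v → ∃[ e ] Endpoints e u v
  edge∃ {u} {v} u~v with Fin.<-cmp u v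
  ... | tri< u<v _ _  = _ , inj₁ (sym (lookup-index (listed u<v u~v)))
  ... | tri≈ _ refl _ = contradiction u~v (Graph.loopless G u)
  ... | tri> _ _ v<u  = _ , inj₂ (sym (lookup-index (listed v<u (Graph.adj-sym G u~v))))

  edge : ∀ {u v} → Adj G u v → Vertex (lineGraph G)
  edge u~v = proj₁ (edge∃ u~v)

  endpoints : ∀ {u v} (u~v : Adj G u v) → Endpoints (edge u~v) u v
  endpoints u~v = proj₂ (edge∃ u~v)

  endpoint-unique : ∀ {e u v w} → Endpoints e u v → Endpoints e u w → v ≡ w
  endpoint-unique (inj₁ p) (inj₁ q) with refl ← trans (sym p) q = refl
  endpoint-unique (inj₁ p) (inj₂ q) with refl ← trans (sym p) q = refl
  endpoint-unique (inj₂ p) (inj₁ q) with refl ← trans (sym p) q = refl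
  endpoint-unique (inj₂ p) (inj₂ q) with refl ← trans (sym p) q = refl

  incident⇒adj : ∀ {e f u v w} → Endpoints e u v → Endpoints f u w → v ≢ w →
    Adj (lineGraph G) e f
  incident⇒adj {e} {f} {u} {v} {w} p q v≢w =
    (λ { refl → v≢w (endpoint-unique p q) }) , share p q
    where
    share : ∀ {a b} → a ≡ (u , v) ⊎ a ≡ (v , u) → b ≡ (u , w) ⊎ b ≡ (w , u) → ShareEndpoint a b
    share (inj₁ refl) (inj₁ refl) = inj₁ (inj₁ refl)
    share (inj₁ refl) (inj₂ refl) = inj₁ (inj₂ refl)
    share (inj₂ refl) (inj₁ refl) = inj₂ (inj₁ refl)
    share (inj₂ refl) (inj₂ refl) = inj₂ (inj₂ refl)

  record Disjoint (u v w x : Vertex G) : Set where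
    constructor disjoint
    field
      u≢w : u ≢ w
      u≢x : u ≢ x
      v≢w : v ≢ w
      v≢x : v ≢ x

  unshared : ∀ {u v w x} → Disjoint u v w x → ¬ ShareEndpoint (u , v) (w , x)
  unshared d = λ where
    (inj₁ (inj₁ eq)) → Disjoint.u≢w d eq
    (inj₁ (inj₂ eq)) → Disjoint.u≢x d eq
    (inj₂ (inj₁ eq)) → Disjoint.v≢w d eq
    (inj₂ (inj₂ eq)) → Disjoint.v≢x d eq

  disjoint⇒unshared : ∀ {a b u v w x} → a ≡ (u , v) ⊎ a ≡ (v , u) → b ≡ (w , x) ⊎ b ≡ (x , w) →
    Disjoint u v w x → ¬ ShareEndpoint a b
  disjoint⇒unshared (inj₁ refl) (inj₁ refl) d = unshared d
  disjoint⇒unshared (inj₁ refl) (inj₂ refl) (disjoint p q r s) = unshared (disjoint q p s r)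
  disjoint⇒unshared (inj₂ refl) (inj₁ refl) (disjoint p q r s) = unshared (disjoint r s p q)
  disjoint⇒unshared (inj₂ refl) (inj₂ refl) (disjoint p q r s) = unshared (disjoint s r q p)

  disjoint⇒¬adj : ∀ {e f u v w x} → Endpoints e u v → Endpoints f w x → Disjoint u v w x →
    ¬ Adj (lineGraph G) e f
  disjoint⇒¬adj p q d (_ , shared) = disjoint⇒unshared p q d shared

  disjoint⇒≢ : ∀ {e f u v w x} → Endpoints e u v → Endpoints f w x → Disjoint u v w x → e ≢ f
  disjoint⇒≢ p q d refl = disjoint⇒unshared p q d (inj₁ (inj₁ refl))

-- The configurations below are subgraphs, not necessarily induced: an edge that is
-- not listed may be present.
record Star₄ (G : Graph) : Set where
  field
    {c x y z w} : Vertex G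
    c~x : Adj G c x
    c~y : Adj G c y
    c~z : Adj G c z
    c~w : Adj G c w
    x≢y : x ≢ y
    x≢z : x ≢ z
    x≢w : x ≢ w
    y≢z : y ≢ z
    y≢w : y ≢ w
    z≢w : z ≢ w

record Fork (G : Graph) : Set where
  field
    {c x y z w} : Vertex G
    c~x : Adj G c x
    c~y : Adj G c y
    c~z : Adj G c z
    z~w : Adj G z w
    x≢y : x ≢ y
    x≢z : x ≢ z
    y≢z : y ≢ z
    w≢c : w ≢ c
    w≢x : w ≢ x
    w≢y : w ≢ y

record Paw (G : Graph) : Set where
  field
    {p q r s} : Vertex G
    p~q : Adj G p q
    r~p : Adj G r p
    r~q : Adj G r q
    r~s : Adj G r s
    s≢p : s ≢ p
    s≢q : s ≢ q

record Diamond (G : Graph) : Set where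
  field
    {p q r s} : Vertex G
    q~r : Adj G q r
    q~p : Adj G q p
    r~p : Adj G r p
    q~s : Adj G q s
    r~s : Adj G r s
    p≢s : p ≢ s

record Wheel₄ (G : Graph) (h a b c d : Vertex G) : Set where
  field
    h~a : Adj G h a
    h~b : Adj G h b
    h~c : Adj G h c
    h~d : Adj G h d
    a~b : Adj G a b
    b~c : Adj G b c
    c~d : Adj G c d
    d~a : Adj G d a
    a≢c : a ≢ c
    b≢d : b ≢ d

record HasWheel₄ (G : Graph) : Set where
  constructor hasWheel₄
  field
    {h a b c d} : Vertex G
    wheel₄      : Wheel₄ G h a b c d

-- Subgraphs carried over to the line graph.

star₄⇒diamond : Star₄ G → Diamond (lineGraph G)
star₄⇒diamond {G} S = record
  { q~r = incident⇒adj G (endpoints G c~x) (endpoints G c~y) x≢y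
  ; q~p = incident⇒adj G (endpoints G c~x) (endpoints G c~z) x≢z
  ; r~p = incident⇒adj G (endpoints G c~y) (endpoints G c~z) y≢z
  ; q~s = incident⇒adj G (endpoints G c~x) (endpoints G c~w) x≢w
  ; r~s = incident⇒adj G (endpoints G c~y) (endpoints G c~w) y≢w
  ; p≢s = adj⇒≢ (lineGraph G) (incident⇒adj G (endpoints G c~z) (endpoints G c~w) z≢w)
  }
  where open Star₄ S

-- The edges at `c` form the triangle, and `zw` hangs from `cz`.
fork⇒paw : Fork G → Paw (lineGraph G)
fork⇒paw {G} F = record
  { p~q = incident⇒adj G (endpoints G c~x) (endpoints G c~y) x≢y
  ; r~p = incident⇒adj G (endpoints G c~z) (endpoints G c~x) (≢-sym x≢z)
  ; r~q = incident⇒adj G (endpoints G c~z) (endpoints G c~y) (≢-sym y≢z)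
  ; r~s = incident⇒adj G (swap (endpoints G c~z)) (endpoints G z~w) (≢-sym w≢c)
  ; s≢p = disjoint⇒≢ G (endpoints G z~w) (endpoints G c~x)
      (disjoint (≢-sym (adj⇒≢ G c~z)) (≢-sym x≢z) w≢c w≢x)
  ; s≢q = disjoint⇒≢ G (endpoints G z~w) (endpoints G c~y)
      (disjoint (≢-sym (adj⇒≢ G c~z)) (≢-sym y≢z) w≢c w≢y)
  }
  where open Fork F

-- The incident edges `rp` and `rq` both meet `pq` and the pendant edge `rs`.
paw⇒diamond : Paw G → Diamond (lineGraph G)
paw⇒diamond {G} P = record
  { q~r = incident⇒adj G (endpoints G r~p) (endpoints G r~q) p≢q
  ; q~p = incident⇒adj G (swap (endpoints G r~p)) (endpoints G p~q) (adj⇒≢ G r~q)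
  ; r~p = incident⇒adj G (swap (endpoints G r~q)) (swap (endpoints G p~q)) (adj⇒≢ G r~p)
  ; q~s = incident⇒adj G (endpoints G r~p) (endpoints G r~s) (≢-sym s≢p)
  ; r~s = incident⇒adj G (endpoints G r~q) (endpoints G r~s) (≢-sym s≢q)
  ; p≢s = disjoint⇒≢ G (endpoints G p~q) (endpoints G r~s)
      (disjoint (≢-sym (adj⇒≢ G r~p)) (≢-sym s≢p) (≢-sym (adj⇒≢ G r~q)) (≢-sym s≢q))
  }
  where
  open Paw P
  p≢q = adj⇒≢ G p~q

-- The hub is qr and the rim is qp, pr, rs, sq.
diamond⇒wheel₄ : Diamond G → HasWheel₄ (lineGraph G)
diamond⇒wheel₄ {G} D = hasWheel₄ record
  { h~a = incident⇒adj G (endpoints G q~r) (endpoints G q~p) r≢p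
  ; h~b = incident⇒adj G (swap (endpoints G q~r)) (endpoints G r~p) q≢p
  ; h~c = incident⇒adj G (swap (endpoints G q~r)) (endpoints G r~s) q≢s
  ; h~d = incident⇒adj G (endpoints G q~r) (endpoints G q~s) r≢s
  ; a~b = incident⇒adj G (swap (endpoints G q~p)) (swap (endpoints G r~p)) q≢r
  ; b~c = incident⇒adj G (endpoints G r~p) (endpoints G r~s) p≢s
  ; c~d = incident⇒adj G (swap (endpoints G r~s)) (swap (endpoints G q~s)) (≢-sym q≢r)
  ; d~a = incident⇒adj G (endpoints G q~s) (endpoints G q~p) (≢-sym p≢s)
  ; a≢c = disjoint⇒≢ G (endpoints G q~p) (endpoints G r~s)
      (disjoint q≢r q≢s (≢-sym r≢p) p≢s)
  ; b≢d = disjoint⇒≢ G (endpoints G r~p) (endpoints G q~s)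
      (disjoint (≢-sym q≢r) r≢s (≢-sym q≢p) p≢s)
  }
  where
  open Diamond D
  q≢r = adj⇒≢ G q~r
  q≢p = adj⇒≢ G q~p
  r≢p = adj⇒≢ G r~p
  q≢s = adj⇒≢ G q~s
  r≢s = adj⇒≢ G r~s

-- The triangles `h a b` and `h b c` share the spoke `hb`.
wheel₄⇒diamond : HasWheel₄ G → Diamond G
wheel₄⇒diamond {G} (hasWheel₄ w) = record
  { q~r = h~b ; q~p = h~a ; r~p = Graph.adj-sym G a~b ; q~s = h~c ; r~s = b~c ; p≢s = a≢c }
  where open Wheel₄ w

-- The line graph of W₄

-- Rotation and reflection carry the spoke proofs along unchanged, so the spokes of a transformed
-- wheel are definitionally those of the original.
rotate : ∀ {G h a b c d} → Wheel₄ G h a b c d → Wheel₄ G h b c d a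
rotate {G} w = record
  { h~a = h~b ; h~b = h~c ; h~c = h~d ; h~d = h~a
  ; a~b = b~c ; b~c = c~d ; c~d = d~a ; d~a = a~b
  ; a≢c = b≢d ; b≢d = ≢-sym a≢c
  }
  where open Wheel₄ w

reflect : ∀ {G h a b c d} → Wheel₄ G h a b c d → Wheel₄ G h a d c b
reflect {G} w = record
  { h~a = h~a ; h~b = h~d ; h~c = h~c ; h~d = h~b
  ; a~b = adj-sym d~a ; b~c = adj-sym c~d ; c~d = adj-sym b~c ; d~a = adj-sym a~b
  ; a≢c = a≢c ; b≢d = ≢-sym b≢d
  }
  where
  open Wheel₄ w
  open Graph G using (adj-sym)

reverse : ∀ {G} → WordOrder G → WordOrder G
reverse {G} O = record
  { _≽_     = λ x y → y ≽ x
  ; ≽-trans = λ y≽x z≽y → ≽-trans z≽y y≽x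
  ; compare = λ x~y → swap (compare x~y)
  ; convexˡ = λ y≽x z≽y x~z x≢y → adj-sym (convexʳ z≽y y≽x (adj-sym x~z) (≢-sym x≢y))
  ; convexʳ = λ y≽x z≽y x~z y≢z → adj-sym (convexˡ z≽y y≽x (adj-sym x~z) (≢-sym y≢z))
  }
  where
  open WordOrder O
  open Graph G using (adj-sym)

module _ {G : Graph} (O : WordOrder (lineGraph G)) where
  open WordOrder O

  private
    L = lineGraph G
    open Graph L using (adj-sym)

    variable
      u v u′ v′ : Vertex G
      e f g : Vertex L

  -- The pattern of every contradiction below: an edge placed between two incident edges must meet
  -- both of them.
  ¬convexˡ : e ≽ f → f ≽ g → Adj L e g →
    Endpoints G e u v → Endpoints G f u′ v′ → Disjoint G u v u′ v′ → ⊥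
  ¬convexˡ e≽f f≽g e~g p q d = disjoint⇒¬adj G p q d (convexˡ e≽f f≽g e~g (disjoint⇒≢ G p q d))

  ¬convexʳ : e ≽ f → f ≽ g → Adj L e g →
    Endpoints G f u v → Endpoints G g u′ v′ → Disjoint G u v u′ v′ → ⊥
  ¬convexʳ e≽f f≽g e~g p q d = disjoint⇒¬adj G p q d (convexʳ e≽f f≽g e~g (disjoint⇒≢ G p q d))

  module Spokes {h a b c d} (w : Wheel₄ G h a b c d) where
    open Wheel₄ w

    h≢a : h ≢ a
    h≢a = adj⇒≢ G h~a
    h≢b : h ≢ b
    h≢b = adj⇒≢ G h~b
    h≢c : h ≢ c
    h≢c = adj⇒≢ G h~c
    h≢d : h ≢ d
    h≢d = adj⇒≢ G h~d
    a≢b : a ≢ b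
    a≢b = adj⇒≢ G a~b
    b≢c : b ≢ c
    b≢c = adj⇒≢ G b~c
    c≢d : c ≢ d
    c≢d = adj⇒≢ G c~d
    d≢a : d ≢ a
    d≢a = adj⇒≢ G d~a

    A B C D AB CD DA : Vertex L
    A  = edge G h~a
    B  = edge G h~b
    C  = edge G h~c
    D  = edge G h~d
    AB = edge G a~b
    CD = edge G c~d
    DA = edge G d~a

    A-ends : Endpoints G A h a
    A-ends = endpoints G h~a
    B-ends : Endpoints G B h b
    B-ends = endpoints G h~b
    C-ends : Endpoints G C h c
    C-ends = endpoints G h~c
    D-ends : Endpoints G D h d
    D-ends = endpoints G h~d
    AB-ends : Endpoints G AB a b
    AB-ends = endpoints G a~b
    CD-ends : Endpoints G CD c d
    CD-ends = endpoints G c~d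
    DA-ends : Endpoints G DA d a
    DA-ends = endpoints G d~a

    A~B : Adj L A B
    A~B = incident⇒adj G A-ends B-ends a≢b
    B~C : Adj L B C
    B~C = incident⇒adj G B-ends C-ends b≢c
    A~C : Adj L A C
    A~C = incident⇒adj G A-ends C-ends a≢c
    B~D : Adj L B D
    B~D = incident⇒adj G B-ends D-ends b≢d
    C~D : Adj L C D
    C~D = incident⇒adj G C-ends D-ends c≢d
    A~D : Adj L A D
    A~D = incident⇒adj G A-ends D-ends (≢-sym d≢a)
    A~AB : Adj L A AB
    A~AB = incident⇒adj G (swap A-ends) AB-ends h≢b
    B~AB : Adj L B AB
    B~AB = incident⇒adj G (swap B-ends) (swap AB-ends) h≢a
    C~CD : Adj L C CD
    C~CD = incident⇒adj G (swap C-ends) CD-ends h≢d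
    D~CD : Adj L D CD
    D~CD = incident⇒adj G (swap D-ends) (swap CD-ends) h≢c
    D~DA : Adj L D DA
    D~DA = incident⇒adj G (swap D-ends) DA-ends h≢a
    A~DA : Adj L A DA
    A~DA = incident⇒adj G (swap A-ends) (swap DA-ends) h≢d

    AB~DA : Adj L AB DA
    AB~DA = incident⇒adj G AB-ends (swap DA-ends) b≢d
    CD~DA : Adj L CD DA
    CD~DA = incident⇒adj G (swap CD-ends) DA-ends (≢-sym a≢c)

    -- The rim edge at A and B cannot be placed: C lies between its two spokes,
    -- and D shows that the rim edge itself cannot lie there.
    ¬separated : A ≽ C → C ≽ B → D ≽ A ⊎ B ≽ D → ⊥
    ¬separated A≽C C≽B D≽A⊎B≽D with compare A~AB | compare B~AB
    ... | inj₂ AB≽A | _ = ¬convexˡ (≽-trans AB≽A A≽C) C≽B (adj-sym B~AB) AB-ends C-ends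
      (disjoint (≢-sym h≢a) a≢c (≢-sym h≢b) b≢c)
    ... | inj₁ A≽AB | inj₁ B≽AB = ¬convexʳ A≽C (≽-trans C≽B B≽AB) A~AB C-ends AB-ends
      (disjoint h≢a h≢b (≢-sym a≢c) (≢-sym b≢c))
    ... | inj₁ A≽AB | inj₂ AB≽B with D≽A⊎B≽D
    ...   | inj₁ D≽A = ¬convexˡ (≽-trans D≽A A≽AB) AB≽B (adj-sym B~D) D-ends AB-ends
      (disjoint h≢a h≢b d≢a (≢-sym b≢d))
    ...   | inj₂ B≽D = ¬convexʳ A≽AB (≽-trans AB≽B B≽D) A~D AB-ends D-ends
      (disjoint (≢-sym h≢a) (≢-sym d≢a) (≢-sym h≢b) b≢d)

    -- `BC` is a parameter known only by its endpoints, because a reflected wheel carries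
    -- `adj-sym b~c`, and the edge chosen for that proof need not be definitionally the one chosen
    -- for `b~c`.
    module _ {BC : Vertex L} (BC-ends : Endpoints G BC b c) where
      private
        B~BC : Adj L B BC
        B~BC = incident⇒adj G (swap B-ends) BC-ends h≢c
        C~BC : Adj L C BC
        C~BC = incident⇒adj G (swap C-ends) (swap BC-ends) h≢b
        AB~BC : Adj L AB BC
        AB~BC = incident⇒adj G (swap AB-ends) BC-ends a≢c
        BC~CD : Adj L BC CD
        BC~CD = incident⇒adj G (swap BC-ends) CD-ends b≢d

        A∥BC : Disjoint G h a b c
        A∥BC = disjoint h≢b h≢c a≢b a≢c
        A∥CD : Disjoint G h a c d
        A∥CD = disjoint h≢c h≢d a≢c (≢-sym d≢a)
        B∥CD : Disjoint G h b c d
        B∥CD = disjoint h≢c h≢d b≢c b≢d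
        B∥DA : Disjoint G h b d a
        B∥DA = disjoint h≢d h≢a b≢d (≢-sym a≢b)
        AB∥D : Disjoint G a b h d
        AB∥D = disjoint (≢-sym h≢a) (≢-sym d≢a) (≢-sym h≢b) b≢d
        AB∥CD : Disjoint G a b c d
        AB∥CD = disjoint a≢c (≢-sym d≢a) b≢c b≢d
        BC∥A : Disjoint G b c h a
        BC∥A = disjoint (≢-sym h≢b) (≢-sym a≢b) (≢-sym h≢c) (≢-sym a≢c)
        BC∥DA : Disjoint G b c d a
        BC∥DA = disjoint b≢d (≢-sym a≢b) c≢d (≢-sym a≢c)
        CD∥B : Disjoint G c d h b
        CD∥B = disjoint (≢-sym h≢c) (≢-sym b≢c) (≢-sym h≢d) (≢-sym b≢d)
        DA∥B : Disjoint G d a h b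
        DA∥B = disjoint (≢-sym h≢d) (≢-sym b≢d) (≢-sym h≢a) a≢b

      module _ (A≽B : A ≽ B) (B≽C : B ≽ C) (C≽D : C ≽ D) where
        private
          A≽C : A ≽ C
          A≽C = ≽-trans A≽B B≽C
          B≽D : B ≽ D
          B≽D = ≽-trans B≽C C≽D

        -- `A` and `D` are the ends of the chain. If `DA` were above `A` or below `D`, then `B`
        -- would lie between `DA` and the spoke at the far end, yet `B` is disjoint from `DA`.
        A≽DA : A ≽ DA
        A≽DA with compare A~DA
        ... | inj₁ A≽DA = A≽DA
        ... | inj₂ DA≽A = ⊥-elim (¬convexˡ (≽-trans DA≽A A≽B) B≽D (adj-sym D~DA) DA-ends B-ends DA∥B)

        DA≽D : DA ≽ D
        DA≽D with compare D~DA
        ... | inj₂ DA≽D = DA≽D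
        ... | inj₁ D≽DA = ⊥-elim (¬convexʳ A≽B (≽-trans B≽D D≽DA) A~DA B-ends DA-ends B∥DA)

        -- Between `B` and `C`, the edge `BC` would also lie between the adjacent `A` and `D`, but
        -- it is disjoint from `A`.
        BC-outside : BC ≽ B ⊎ C ≽ BC
        BC-outside with compare B~BC | compare C~BC
        ... | inj₂ BC≽B | _         = inj₁ BC≽B
        ... | inj₁ _    | inj₁ C≽BC = inj₂ C≽BC
        ... | inj₁ B≽BC | inj₂ BC≽C =
          ⊥-elim (¬convexˡ (≽-trans A≽B B≽BC) (≽-trans BC≽C C≽D) A~D A-ends BC-ends A∥BC)

        -- The rim edges other than DA are forced into BC ≽ CD ≽ DA, and AB
        -- then has no place.
        BC-not-above : BC ≽ B → ⊥
        BC-not-above BC≽B = AB-nowhere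
          where
          -- Below both its spokes, `CD` would leave `B` between `BC` and `CD`; between them, it
          -- would lie between `A` and `D`.
          CD≽C : CD ≽ C
          CD≽C with compare C~CD | compare D~CD
          ... | inj₂ CD≽C | _         = CD≽C
          ... | inj₁ C≽CD | inj₁ D≽CD =
            ⊥-elim (¬convexʳ BC≽B (≽-trans B≽C C≽CD) BC~CD B-ends CD-ends B∥CD)
          ... | inj₁ C≽CD | inj₂ CD≽D =
            ⊥-elim (¬convexˡ (≽-trans A≽C C≽CD) CD≽D A~D A-ends CD-ends A∥CD)

          CD≽DA : CD ≽ DA
          CD≽DA with compare CD~DA
          ... | inj₁ CD≽DA = CD≽DA
          ... | inj₂ DA≽CD =
            ⊥-elim (¬convexˡ (≽-trans A≽DA DA≽CD) (≽-trans CD≽C C≽D) A~D A-ends CD-ends A∥CD)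

          BC≽CD : BC ≽ CD
          BC≽CD with compare BC~CD
          ... | inj₁ BC≽CD = BC≽CD
          ... | inj₂ CD≽BC =
            ⊥-elim (¬convexˡ (≽-trans CD≽BC BC≽B) B≽C (adj-sym C~CD) CD-ends B-ends CD∥B)

          AB-nowhere : ⊥
          AB-nowhere with compare A~AB | compare B~AB
          ... | inj₁ A≽AB | inj₂ AB≽B = ¬convexʳ A≽AB (≽-trans AB≽B B≽D) A~D AB-ends D-ends AB∥D
          -- `AB` above `A`: either `CD` separates it from `DA`, or `A` separates `BC` from `B`.
          AB-nowhere | inj₂ AB≽A | _ with compare AB~BC
          ... | inj₁ AB≽BC = ¬convexˡ (≽-trans AB≽BC BC≽CD) CD≽DA AB~DA AB-ends CD-ends AB∥CD
          ... | inj₂ BC≽AB = ¬convexˡ (≽-trans BC≽AB AB≽A) A≽B (adj-sym B~BC) BC-ends A-ends BC∥A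
          -- `AB` below `B`: either it lies between `A` and `D`, or `DA` separates it from `BC`.
          AB-nowhere | inj₁ _ | inj₁ B≽AB with compare AB~DA
          ... | inj₁ AB≽DA = ¬convexʳ (≽-trans A≽B B≽AB) (≽-trans AB≽DA DA≽D) A~D AB-ends D-ends AB∥D
          ... | inj₂ DA≽AB =
            ¬convexˡ (≽-trans BC≽CD CD≽DA) DA≽AB (adj-sym AB~BC) BC-ends DA-ends BC∥DA

module _ {G : Graph} (O : WordOrder (lineGraph G)) where
  open WordOrder O

  private
    L = lineGraph G

    spoke : ∀ {h a b c d} → Wheel₄ G h a b c d → Vertex L
    spoke w = edge G (Wheel₄.h~a w)

  ¬cyclic : ∀ {h a b c d} (w : Wheel₄ G h a b c d) → let w′ = rotate w; w″ = rotate w′ in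
    spoke w ≽ spoke w′ → spoke w′ ≽ spoke w″ → spoke w″ ≽ spoke (rotate w″) → ⊥
  ¬cyclic w A≽B B≽C C≽D with Spokes.BC-outside O w (endpoints G (Wheel₄.b~c w)) A≽B B≽C C≽D
  ... | inj₁ BC≽B = Spokes.BC-not-above O w (endpoints G (Wheel₄.b~c w)) A≽B B≽C C≽D BC≽B
  -- The opposite order has the chain `D`, `C`, `B`, `A`, which is the rim order of
  -- `rotate (reflect w)`; there `C≽BC` places the edge above its upper spoke.
  ... | inj₂ C≽BC = Spokes.BC-not-above (reverse O) (rotate (reflect w))
                      (swap (endpoints G (Wheel₄.b~c w))) C≽D B≽C A≽B C≽BC

  -- If `C` falls between `B` and `D`, the chain follows the rim. If `C` is second, it separates `A`
  -- from the third spoke, with the fourth below. If `C` is last, the third spoke separates the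
  -- second from `C`, with `A` above.
  ¬top : ∀ {h a b c d} (w : Wheel₄ G h a b c d) → let w′ = rotate w; w″ = rotate w′; w‴ = rotate w″ in
    spoke w ≽ spoke w′ → spoke w ≽ spoke w″ → spoke w ≽ spoke w‴ → ⊥
  ¬top w A≽B A≽C A≽D with compare B~C | compare C~D | compare B~D
    where open Spokes O w
  ... | inj₁ B≽C | inj₁ C≽D | _        = ¬cyclic w A≽B B≽C C≽D
  ... | inj₂ C≽B | inj₂ D≽C | _        = ¬cyclic (reflect w) A≽D D≽C C≽B
  ... | inj₂ C≽B | inj₁ C≽D | inj₁ B≽D = Spokes.¬separated O w A≽C C≽B (inj₂ B≽D)
  ... | inj₂ C≽B | inj₁ C≽D | inj₂ D≽B = Spokes.¬separated O (reflect w) A≽C C≽D (inj₂ D≽B)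
  ... | inj₁ B≽C | inj₂ D≽C | inj₁ B≽D = Spokes.¬separated O (rotate w) B≽D D≽C (inj₁ A≽B)
  ... | inj₁ B≽C | inj₂ D≽C | inj₂ D≽B =
    Spokes.¬separated O (rotate (reflect w)) D≽B B≽C (inj₁ A≽D)

  -- A knockout among the spokes finds the top one: opposite spokes are compared first, then the two
  -- winners.
  ¬wheel₄ : ¬ HasWheel₄ G
  ¬wheel₄ (hasWheel₄ w) with compare A~C | compare B~D
    where open Spokes O w
  ¬wheel₄ (hasWheel₄ w) | inj₁ A≽C | inj₁ B≽D with compare (Spokes.A~B O w)
  ... | inj₁ A≽B = ¬top w A≽B A≽C (≽-trans A≽B B≽D)
  ... | inj₂ B≽A = ¬top (rotate w) (≽-trans B≽A A≽C) B≽D B≽A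
  ¬wheel₄ (hasWheel₄ w) | inj₁ A≽C | inj₂ D≽B with compare (Spokes.A~D O w)
  ... | inj₁ A≽D = ¬top w (≽-trans A≽D D≽B) A≽C A≽D
  ... | inj₂ D≽A = ¬top (rotate (rotate (rotate w))) D≽A D≽B (≽-trans D≽A A≽C)
  ¬wheel₄ (hasWheel₄ w) | inj₂ C≽A | inj₁ B≽D with compare (Spokes.B~C O w)
  ... | inj₁ B≽C = ¬top (rotate w) B≽C B≽D (≽-trans B≽C C≽A)
  ... | inj₂ C≽B = ¬top (rotate (rotate w)) (≽-trans C≽B B≽D) C≽A C≽B
  ¬wheel₄ (hasWheel₄ w) | inj₂ C≽A | inj₂ D≽B with compare (Spokes.C~D O w)
  ... | inj₁ C≽D = ¬top (rotate (rotate w)) C≽D C≽A (≽-trans C≽D D≽B)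
  ... | inj₂ D≽C = ¬top (rotate (rotate (rotate w))) (≽-trans D≽C C≽A) D≽B D≽C

-- Connected graphs with and without claws

connected-closure : ∀ G → Connected G → (P : Vertex G → Set) →
  (∀ {u v} → P u → Adj G u v → P v) → ∀ {u} → P u → ∀ v → P v
connected-closure G (_ , walk) P closed {u} Pu v = go Pu (walk u v)
  where
  go : ∀ {u v} → P u → Star (Adj G) u v → P v
  go Pu ε         = Pu
  go Pu (u~w ◅ p) = go (closed Pu u~w) p

Onto : ∀ {m n} → (Fin m → Fin n) → Set
Onto p = ∀ v → ∃[ i ] p i ≡ v

onto⇒≅ : ∀ {G H} (p : Vertex H → Vertex G) → Injective _≡_ _≡_ p → Onto p →
  (∀ i j → Adj G (p i) (p j) ⇔ Adj H i j) → G ≅ H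
onto⇒≅ {G} {H} p inj onto iff = record
  { bijection = mk↔ₛ′ index p (λ i → inj (p-index (p i))) p-index
  ; preserves = λ u v → mk⇔
      (Equivalence.to (iff _ _) ∘ subst₂ (Adj G) (sym (p-index u)) (sym (p-index v)))
      (subst₂ (Adj G) (p-index u) (p-index v) ∘ Equivalence.from (iff _ _))
  }
  where
  index : Vertex G → Vertex H
  index v = proj₁ (onto v)

  p-index : ∀ v → p (index v) ≡ v
  p-index v = proj₂ (onto v)

-- The model graphs are symmetric closures of an oriented relation `R`, so edges of `G` need
-- examining only for `i` before `j`. For a graph built by `undirected`, the first two arguments are
-- `inj₁` and `id`.
orientation⇒≅ : ∀ {G} H {R : Rel (Vertex H) 0ℓ} →
  (∀ {i j} → R i j → Adj H i j) → (∀ {i j} → Adj H i j → R i j ⊎ R j i) →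
  (p : Vertex H → Vertex G) → Injective _≡_ _≡_ p → Onto p →
  (∀ {i j} → R i j → Adj G (p i) (p j)) →
  (∀ {i j} → Adj G (p i) (p j) → toℕ i < toℕ j → R i j) →
  G ≅ H
orientation⇒≅ {G} H R⇒adjᴴ adjᴴ⇒R p inj onto R⇒adj adj⇒R = onto⇒≅ p inj onto λ i j → mk⇔ (to i j) from
  where
  to : ∀ i j → Adj G (p i) (p j) → Adj H i j
  to i j i~j with <-cmp (toℕ i) (toℕ j)
  ... | tri< i<j _ _ = R⇒adjᴴ (adj⇒R i~j i<j)
  ... | tri≈ _ i≡j _ = contradiction (cong p (toℕ-injective i≡j)) (adj⇒≢ G i~j)
  ... | tri> _ _ j<i = Graph.adj-sym H (R⇒adjᴴ (adj⇒R (Graph.adj-sym G i~j) j<i))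

  from : ∀ {i j} → Adj H i j → Adj G (p i) (p j)
  from i~j with adjᴴ⇒R i~j
  ... | inj₁ r = R⇒adj r
  ... | inj₂ r = Graph.adj-sym G (R⇒adj r)

-- The leaves may be adjacent to each other: this only says that `c` has degree at least 3.
record IsClawAt (G : Graph) (c x y z : Vertex G) : Set where
  constructor clawAt
  field
    c~x : Adj G c x
    c~y : Adj G c y
    c~z : Adj G c z
    x≢y : x ≢ y
    x≢z : x ≢ z
    y≢z : y ≢ z

HasClaw : Graph → Set
HasClaw G = ∃[ c ] ∃[ x ] ∃[ y ] ∃[ z ] IsClawAt G c x y z

hasClaw? : ∀ G → Dec (HasClaw G)
hasClaw? G = any? λ c → any? λ x → any? λ y → any? λ z →
  map′ (λ (p , q , r , s , t , u) → clawAt p q r s t u) (λ (clawAt p q r s t u) → p , q , r , s , t , u)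
    (adj? c x ×-dec adj? c y ×-dec adj? c z ×-dec ¬? (x ≟ y) ×-dec ¬? (x ≟ z) ×-dec ¬? (y ≟ z))
  where
  open Graph G using (adj?)

-- Paths that cannot be extended at either end.

record Path (G : Graph) {m} (p : Fin m → Vertex G) : Set where
  field
    injective : Injective _≡_ _≡_ p
    step      : ∀ {i j} → suc (toℕ i) ≡ toℕ j → Adj G (p i) (p j)

module _ {G : Graph} where
  open Graph G using (adj?; adj-sym)

  path-≤ : ∀ {m} {p : Fin m → Vertex G} → Path G p → m ≤ order G
  path-≤ P = injective⇒≤ (Path.injective P)

  _◂_ : ∀ {m} → Vertex G → (Fin m → Vertex G) → Fin (suc m) → Vertex G
  (w ◂ p) zero    = w
  (w ◂ p) (suc i) = p i

  Covers : ∀ {m} → (Fin m → Vertex G) → Vertex G → Set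
  Covers p v = ∃[ i ] p i ≡ v

  covers? : ∀ {m} (p : Fin m → Vertex G) v → Dec (Covers p v)
  covers? p v = any? λ i → p i ≟ v

  ◂-path : ∀ {m w} {p : Fin (suc m) → Vertex G} → Path G p → Adj G w (p zero) → ¬ Covers p w →
    Path G (w ◂ p)
  ◂-path {m} {w} {p} P w~p w∉p = record { injective = inj ; step = step }
    where
    inj : Injective _≡_ _≡_ (w ◂ p)
    inj {zero}  {zero}  eq = refl
    inj {zero}  {suc j} eq = contradiction (j , sym eq) w∉p
    inj {suc i} {zero}  eq = contradiction (i , eq) w∉p
    inj {suc i} {suc j} eq = cong suc (Path.injective P eq)

    step : ∀ {i j} → suc (toℕ i) ≡ toℕ j → Adj G ((w ◂ p) i) ((w ◂ p) j)
    step {zero}  {suc zero} _  = w~p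
    step {suc i} {suc j}    eq = Path.step P (suc-injective eq)

  reverse-path : ∀ {m} {p : Fin m → Vertex G} → Path G p → Path G (p ∘ opposite)
  reverse-path {m} {p} P = record
    { injective = λ {i} {j} eq → trans (sym (opposite-involutive i))
        (trans (cong opposite (Path.injective P eq)) (opposite-involutive j))
    ; step = λ {i} {j} eq → adj-sym (Path.step P (opposite-step i j eq))
    }
    where
    opposite-step : ∀ i j → suc (toℕ i) ≡ toℕ j → suc (toℕ (opposite j)) ≡ toℕ (opposite i)
    opposite-step i j eq = begin
      suc (toℕ (opposite j)) ≡⟨ cong suc (opposite-prop j) ⟩
      suc (m ∸ suc (toℕ j))  ≡⟨ sym (+-∸-assoc 1 (toℕ<n j)) ⟩
      m ∸ toℕ j              ≡⟨ cong (m ∸_) (sym eq) ⟩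
      m ∸ suc (toℕ i)        ≡⟨ sym (opposite-prop i) ⟩
      toℕ (opposite i)       ∎
      where open ≡-Reasoning

  Stuck : ∀ {m} → (Fin (suc m) → Vertex G) → Vertex G → Set
  Stuck p u = ∀ {w} → Adj G w u → Covers p w

  stuck? : ∀ {m} (p : Fin (suc m) → Vertex G) u → Stuck p u ⊎ ∃[ w ] Adj G w u × ¬ Covers p w
  stuck? p u with any? (λ w → adj? w u ×-dec ¬? (covers? p w))
  ... | yes ext  = inj₂ ext
  ... | no  none = inj₁ λ {w} w~u → decidable-stable (covers? p w) λ w∉p → none (w , w~u , w∉p)

  record MaximalPath : Set where
    field
      {m}       : ℕ
      p         : Fin (suc m) → Vertex G
      path      : Path G p
      stuckHead : Stuck p (p zero)
      stuckLast : Stuck p (p (fromℕ m))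

  -- The bound keeps the sum of length and fuel above `order G`; a path, being injective, is no
  -- longer than that, so the fuel cannot run out.
  grow : ∀ fuel {m} {p : Fin (suc m) → Vertex G} → order G < suc m + fuel → Path G p → MaximalPath
  grow zero {m} bound P = contradiction (path-≤ P) (<⇒≱ (subst (order G <_) (+-identityʳ (suc m)) bound))
  grow (suc fuel) {m} {p} bound P with stuck? p (p zero)
  ... | inj₂ (w , w~ , w∉) = grow fuel (subst (order G <_) (+-suc (suc m) fuel) bound) (◂-path P w~ w∉)
  ... | inj₁ stuckHead with stuck? p (p (fromℕ m))
  ...   | inj₁ stuckLast = record { path = P ; stuckHead = stuckHead ; stuckLast = stuckLast }
  -- A vertex is added at the far end by prepending it to the reversed path.
  ...   | inj₂ (w , w~ , w∉) = grow fuel (subst (order G <_) (+-suc (suc m) fuel) bound)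
    (◂-path (reverse-path P) w~ λ (i , eq) → w∉ (opposite i , eq))

  maximalPath : Vertex G → MaximalPath
  maximalPath v = grow (order G) {p = λ _ → v} (n<1+n _) record
    { injective = λ { {zero} {zero} _ → refl }
    ; step      = λ { {zero} {zero} () }
    }

-- Connected graphs of maximum degree at most 2.

module Clawless {G : Graph} (conn : Connected G) (clawless : ¬ HasClaw G)
                (maximal : MaximalPath {G}) where
  open Graph G using (adj?; adj-sym)
  open MaximalPath {G} maximal
  open Path path

  predecessor : ∀ (i : Fin (suc m)) → toℕ i ≡ 0 ⊎ Σ[ i⁻ ∈ Fin (suc m) ] suc (toℕ i⁻) ≡ toℕ i
  predecessor zero    = inj₁ refl
  predecessor (suc i) = inj₂ (inject₁ i , cong suc (toℕ-inject₁ i))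

  successor : ∀ (i : Fin (suc m)) → toℕ i ≡ m ⊎ Σ[ i⁺ ∈ Fin (suc m) ] suc (toℕ i) ≡ toℕ i⁺
  successor i with m≤n⇒m<n∨m≡n (s≤s⁻¹ (toℕ<n i))
  ... | inj₁ i<m = inj₂ (fromℕ< (s≤s i<m) , sym (toℕ-fromℕ< (s≤s i<m)))
  ... | inj₂ i≡m = inj₁ i≡m

  last : ∀ {i} → toℕ i ≡ m → i ≡ fromℕ m
  last i≡m = toℕ-injective (trans i≡m (sym (toℕ-fromℕ m)))

  interior-neighbours : ∀ {i i⁻ i⁺ w} → suc (toℕ i⁻) ≡ toℕ i → suc (toℕ i) ≡ toℕ i⁺ →
    Adj G (p i) w → p i⁻ ≡ w ⊎ p i⁺ ≡ w
  interior-neighbours {i} {i⁻} {i⁺} {w} pred succ i~w with p i⁻ ≟ w | p i⁺ ≟ w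
  ... | yes eq | _      = inj₁ eq
  ... | no  _  | yes eq = inj₂ eq
  ... | no  ≢⁻ | no  ≢⁺ = ⊥-elim (clawless (p i , p i⁻ , p i⁺ , w ,
    clawAt (adj-sym (step pred)) (step succ) i~w (i⁻≢i⁺ ∘ injective) ≢⁻ ≢⁺))
    where
    i⁻≢i⁺ : i⁻ ≢ i⁺
    i⁻≢i⁺ refl = <-asym (≤-reflexive pred) (≤-reflexive succ)

  -- At the two ends maximality applies; an interior vertex already has two neighbours on the path.
  covers-neighbour : ∀ {u v} → Covers {G} p u → Adj G u v → Covers {G} p v
  covers-neighbour (i , refl) u~v with predecessor i | successor i
  ... | inj₁ i≡0 | _ = stuckHead (adj-sym (subst (λ j → Adj G (p j) _) (toℕ-injective i≡0) u~v))
  ... | inj₂ _ | inj₁ i≡m = stuckLast (adj-sym (subst (λ j → Adj G (p j) _) (last i≡m) u~v))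
  ... | inj₂ (i⁻ , pred) | inj₂ (i⁺ , succ) with interior-neighbours pred succ u~v
  ...   | inj₁ eq = i⁻ , eq
  ...   | inj₂ eq = i⁺ , eq

  onto : Onto p
  onto = connected-closure G conn (Covers {G} p) covers-neighbour (zero , refl)

  -- If either vertex is interior, the other is next to it on the path; otherwise they are the two
  -- ends.
  chord : ∀ {i j} → Adj G (p i) (p j) → toℕ i < toℕ j →
    suc (toℕ i) ≡ toℕ j ⊎ (toℕ i ≡ 0 × toℕ j ≡ m)
  chord {i} {j} i~j i<j with predecessor i | successor i | predecessor j | successor j
  ... | _ | inj₁ i≡m | _ | _ =
    contradiction (s≤s⁻¹ (toℕ<n j)) (<⇒≱ (subst (_< toℕ j) i≡m i<j))
  ... | _ | _ | inj₁ j≡0 | _ = contradiction (subst (toℕ i <_) j≡0 i<j) λ ()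
  ... | inj₁ i≡0 | _ | _ | inj₁ j≡m = inj₂ (i≡0 , j≡m)
  ... | inj₂ (i⁻ , pred) | inj₂ (i⁺ , succ) | _ | _ with interior-neighbours pred succ i~j
  ...   | inj₁ eq with refl ← injective eq = contradiction (≤-reflexive pred) (<-asym i<j)
  ...   | inj₂ eq with refl ← injective eq = inj₁ succ
  chord {i} {j} i~j i<j | inj₁ _ | _ | inj₂ (j⁻ , pred) | inj₂ (j⁺ , succ)
    with interior-neighbours pred succ (adj-sym i~j)
  ...   | inj₁ eq with refl ← injective eq = inj₁ pred
  ...   | inj₂ eq with refl ← injective eq = contradiction (≤-reflexive succ) (<-asym i<j)

  closed⇒cycle : 2 ≤ m → Adj G (p zero) (p (fromℕ m)) → IsCycle G
  closed⇒cycle 2≤m closed = suc m , s≤s 2≤m , orientation⇒≅ (cycleGraph (suc m)) inj₁ id p injective onto to from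
    where
    R : Rel (Fin (suc m)) 0ℓ
    R i j = suc (toℕ i) ≡ toℕ j ⊎ (i ≢ j × toℕ i ≡ 0 × suc (toℕ j) ≡ suc m)

    to : ∀ {i j} → R i j → Adj G (p i) (p j)
    to (inj₁ eq) = step eq
    to (inj₂ (_ , i≡0 , j≡m)) with refl ← toℕ-injective {j = zero} i≡0 | refl ← last (suc-injective j≡m) = closed

    from : ∀ {i j} → Adj G (p i) (p j) → toℕ i < toℕ j → R i j
    from i~j i<j with chord i~j i<j
    ... | inj₁ eq          = inj₁ eq
    ... | inj₂ (i≡0 , j≡m) = inj₂ ((λ { refl → <-irrefl refl i<j }) , i≡0 , cong suc j≡m)

  open⇒path : ¬ (2 ≤ m × Adj G (p zero) (p (fromℕ m))) → IsPath G
  open⇒path ¬closed = suc m , s≤s z≤n , orientation⇒≅ (pathGraph (suc m)) inj₁ id p injective onto step from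
    where
    from : ∀ {i j} → Adj G (p i) (p j) → toℕ i < toℕ j → suc (toℕ i) ≡ toℕ j
    from {i} {j} i~j i<j with chord i~j i<j
    ... | inj₁ eq = eq
    ... | inj₂ (i≡0 , j≡m) with m≤n⇒m<n∨m≡n i<j
    ...   | inj₂ eq = eq
    ...   | inj₁ 1+i<j = contradiction
      ( subst₂ (λ a b → suc a < b) i≡0 j≡m 1+i<j
      , subst₂ (λ a b → Adj G (p a) (p b)) (toℕ-injective i≡0) (last j≡m) i~j
      ) ¬closed

  path⊎cycle : IsPath G ⊎ IsCycle G
  -- For `m` equal to 1 the ends are adjacent along the path itself, which closes no cycle.
  path⊎cycle with (2 ≤? m) ×-dec adj? (p zero) (p (fromℕ m))
  ... | yes (2≤m , closed) = inj₂ (closed⇒cycle 2≤m closed)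
  ... | no ¬closed         = inj₁ (open⇒path ¬closed)

-- Connected graphs with a vertex of degree at least 3.

module Clawful {G : Graph} (conn : Connected G) {c x y z : Vertex G} (claw : IsClawAt G c x y z) where
  open Graph G using (adj?)
  open IsClawAt claw

  p : Fin 4 → Vertex G
  p 0F = c
  p 1F = x
  p 2F = y
  p 3F = z

  Escape : Set
  Escape = ∃[ i ] ∃[ w ] Adj G (p i) w × ¬ Covers {G} p w

  escape? : Dec Escape
  escape? = any? λ i → any? λ w → adj? (p i) w ×-dec ¬? (covers? {G} p w)

  -- An edge leaving from the centre adds a fourth leaf; one leaving from a leaf lengthens that
  -- prong.
  escape⇒star₄⊎fork : Escape → Star₄ G ⊎ Fork G
  escape⇒star₄⊎fork (i , w , i~w , w∉p) = go i i~w
    where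
    w≢ : ∀ i → w ≢ p i
    w≢ i eq = w∉p (i , sym eq)

    go : ∀ i → Adj G (p i) w → Star₄ G ⊎ Fork G
    go 0F c~w = inj₁ record
      { c~x = c~x ; c~y = c~y ; c~z = c~z ; c~w = c~w
      ; x≢y = x≢y ; x≢z = x≢z ; x≢w = ≢-sym (w≢ 1F)
      ; y≢z = y≢z ; y≢w = ≢-sym (w≢ 2F) ; z≢w = ≢-sym (w≢ 3F) }
    go 1F x~w = inj₂ record
      { c~x = c~y ; c~y = c~z ; c~z = c~x ; z~w = x~w
      ; x≢y = y≢z ; x≢z = ≢-sym x≢y ; y≢z = ≢-sym x≢z
      ; w≢c = w≢ 0F ; w≢x = w≢ 2F ; w≢y = w≢ 3F }
    go 2F y~w = inj₂ record
      { c~x = c~x ; c~y = c~z ; c~z = c~y ; z~w = y~w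
      ; x≢y = x≢z ; x≢z = x≢y ; y≢z = ≢-sym y≢z
      ; w≢c = w≢ 0F ; w≢x = w≢ 1F ; w≢y = w≢ 3F }
    go 3F z~w = inj₂ record
      { c~x = c~x ; c~y = c~y ; c~z = c~z ; z~w = z~w
      ; x≢y = x≢y ; x≢z = x≢z ; y≢z = y≢z
      ; w≢c = w≢ 0F ; w≢x = w≢ 1F ; w≢y = w≢ 2F }

  ¬escape⇒onto : ¬ Escape → Onto p
  ¬escape⇒onto none = connected-closure G conn (Covers {G} p)
    (λ { {v = w} (i , refl) i~w → decidable-stable (covers? {G} p w) λ w∉p → none (i , w , i~w , w∉p) })
    (0F , refl)

  centre~leaf : ∀ i → Adj G c (p (suc i))
  centre~leaf 0F = c~x
  centre~leaf 1F = c~y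
  centre~leaf 2F = c~z

  p-distinct : ∀ i j → toℕ i < toℕ j → p i ≢ p j
  p-distinct 0F (suc j) _ = adj⇒≢ G (centre~leaf j)
  p-distinct 1F 2F      _ = x≢y
  p-distinct 1F 3F      _ = x≢z
  p-distinct 2F 3F      _ = y≢z
  p-distinct (suc _) 1F (s≤s ())
  p-distinct 2F 2F (s≤s (s≤s ()))
  p-distinct 3F 2F (s≤s (s≤s ()))
  p-distinct 3F 3F (s≤s (s≤s (s≤s ())))

  p-injective : Injective _≡_ _≡_ p
  p-injective {i} {j} eq with <-cmp (toℕ i) (toℕ j)
  ... | tri< i<j _ _ = contradiction eq (p-distinct i j i<j)
  ... | tri≈ _ i≡j _ = toℕ-injective i≡j
  ... | tri> _ _ j<i = contradiction (sym eq) (p-distinct j i j<i)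

  -- The two leaves and the centre form a triangle, from which the third leaf hangs.
  leaves-adjacent⇒paw : ∀ i j → toℕ i < toℕ j → Adj G (p (suc i)) (p (suc j)) → Paw G
  leaves-adjacent⇒paw 0F 1F _ x~y = record
    { p~q = x~y ; r~p = c~x ; r~q = c~y ; r~s = c~z ; s≢p = ≢-sym x≢z ; s≢q = ≢-sym y≢z }
  leaves-adjacent⇒paw 0F 2F _ x~z = record
    { p~q = x~z ; r~p = c~x ; r~q = c~z ; r~s = c~y ; s≢p = ≢-sym x≢y ; s≢q = y≢z }
  leaves-adjacent⇒paw 1F 2F _ y~z = record
    { p~q = y~z ; r~p = c~y ; r~q = c~z ; r~s = c~x ; s≢p = x≢y ; s≢q = x≢z }
  leaves-adjacent⇒paw 1F 1F (s≤s ())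
  leaves-adjacent⇒paw 2F 1F (s≤s ())
  leaves-adjacent⇒paw 2F 2F (s≤s (s≤s ()))

  isClaw : Onto p → ¬ Paw G → IsClaw G
  isClaw onto ¬paw = orientation⇒≅ (completeBipartite 1 3) inj₁ id p p-injective onto to from
    where
    to : ∀ {i j} → toℕ i < 1 × 1 ≤ toℕ j → Adj G (p i) (p j)
    to {zero}  {suc j} _            = centre~leaf j
    to {suc _}         (s≤s () , _)

    from : ∀ {i j} → Adj G (p i) (p j) → toℕ i < toℕ j → toℕ i < 1 × 1 ≤ toℕ j
    from {zero}  {suc _} _   _         = s≤s z≤n , s≤s z≤n
    from {suc i} {suc j} i~j (s≤s i<j) = contradiction (leaves-adjacent⇒paw i j i<j i~j) ¬paw

-- The double negation avoids a search for a paw: `none` supplies the absence of paws that `isClaw`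
-- asks for.
star₄⊎fork⊎paw : ∀ {G} → Connected G → ¬ IsPath G → ¬ IsCycle G → ¬ IsClaw G →
  ¬ ¬ ((Star₄ G ⊎ Fork G) ⊎ Paw G)
star₄⊎fork⊎paw {G} conn ¬path ¬cycle ¬claw none with hasClaw? G
... | no clawless with Clawless.path⊎cycle conn clawless (maximalPath (proj₁ conn))
...   | inj₁ path  = ¬path path
...   | inj₂ cycle = ¬cycle cycle
star₄⊎fork⊎paw {G} conn ¬path ¬cycle ¬claw none | yes (_ , _ , _ , _ , claw) with Clawful.escape? conn claw
... | yes esc = none (inj₁ (Clawful.escape⇒star₄⊎fork conn claw esc))
... | no ¬esc = ¬claw (Clawful.isClaw conn claw (Clawful.¬escape⇒onto conn claw ¬esc) (none ∘ inj₂))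

-- Wheels in iterated line graphs.

wheel₄-persists : ∀ G → HasWheel₄ G → HasWheel₄ (lineGraph G)
wheel₄-persists G w = diamond⇒wheel₄ {G} (wheel₄⇒diamond {G} w)

-- The fork sets the exponent 3; the other two give a wheel in `L²`, which is carried one level
-- further.
wheel₄-lineGraph³ : ∀ G → (Star₄ G ⊎ Fork G) ⊎ Paw G → HasWheel₄ (lineGraph^ 3 G)
wheel₄-lineGraph³ G = λ where
    (inj₁ (inj₁ star)) → wheel₄-persists L² (diamond⇒wheel₄ {L} (star₄⇒diamond {G} star))
    (inj₁ (inj₂ fork)) → diamond⇒wheel₄ {L²} (paw⇒diamond {L} (fork⇒paw {G} fork))
    (inj₂ paw)         → wheel₄-persists L² (diamond⇒wheel₄ {L} (paw⇒diamond {G} paw))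
  where
  L  = lineGraph G
  L² = lineGraph L

wheel₄-lineGraph^ : ∀ G → (Star₄ G ⊎ Fork G) ⊎ Paw G → ∀ {n} → 3 ≤′ n → HasWheel₄ (lineGraph^ n G)
wheel₄-lineGraph^ G found ≤′-refl       = wheel₄-lineGraph³ G found
wheel₄-lineGraph^ G found (≤′-step 3≤n) = wheel₄-persists _ (wheel₄-lineGraph^ G found 3≤n)

theorem4 : (G : Graph) → Connected G → ¬ IsPath G → ¬ IsCycle G → ¬ IsClaw G →
    (n : ℕ) → n ≥ 4 → ¬ Representable (lineGraph^ n G)
theorem4 G conn ¬path ¬cycle ¬claw (suc n) (s≤s n≥3) representable =
  -- The wheel is needed one level below the represented graph, whence 4 rather than 3.
  star₄⊎fork⊎paw conn ¬path ¬cycle ¬claw λ found →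
    ¬wheel₄ {lineGraph^ n G} (representable⇒wordOrder (lineGraph (lineGraph^ n G)) representable)
      (wheel₄-lineGraph^ G found (≤⇒≤′ n≥3))
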